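{- For $n$ even, let $$\Psi_{n,k} := \{v_1\leftrightarrow v_2,\ v_3\leftrightarrow v_4,\ \ldots,\ v_{n-1}\leftrightarrow v_n\}$$ be the CNF in the $n$ propositional variables $v_1,\ldots,v_n$, where $v_i\leftrightarrow v_{i+1}$ abbreviates the two clauses $(v_i\vee\neg v_{i+1})$ and $(v_{i+1}\vee\neg v_i)$. Then, for $k$ odd, $(\Psi_{n,k},k)$ requires size $\geq \left(\frac{n}{2}\right)^{k/2}$ to be refuted in $\mathrm{W}[1]$-parameterized Resolution.
   Context: Resolution is a refutation system for unsatisfiable CNFs, operating on clauses. Its rules are: the resolution rule (from $P\vee x$ and $Q\vee\neg x$ derive $P\vee Q$, where $P,Q$ are disjunctions of literals) and weakening (from $P$ derive $P\vee l$ for a literal $l$). A refutation is a DAG whose sources are labelled by initial clauses, whose internal nodes are labelled by derived clauses, and whose unique sink is labelled by the empty clause. The size of a refutation is the size of this DAG. The weight of an assignment is the number of variables it sets to true. A weighted parameterized contradiction in 3-CNF is a pair $(\mathcal{F},k)$ where $\mathcal{F}$ is a 3-CNF (at most three literals per clause) having no satisfying assignment of weight exactly $k$. A $\mathrm{W}[1]$-parameterized Resolution refutation of such $(\mathcal{F},k)$, with $\mathcal{F}$ in variables $x_1,\ldots,x_n$, is a Resolution refutation of the CNF $$\mathcal{F}\ \cup\ \{\neg x_{i_1}\vee\ldots\vee\neg x_{i_{k+1}} : 1\le i_1<\ldots<i_{k+1}\le n\}\ \cup\ \{x_{i_1}\vee\ldots\vee x_{i_{n-k+1}} : 1\le i_1<\ldots<i_{n-k+1}\le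 n\}.$$ Only those of the additional clauses that actually appear in the refutation count towards its size.
   Formalization: The bound is stated for each odd k and all even n that are sufficiently large in terms of k (unspecified threshold); for all even n it is false, e.g. n = 8, k = 7 has a refutation of size 29 < 4^(7/2) = 128. -}

module Defs where

open import Data.Bool.Base using (true; false)
open import Data.Fin.Base as Fin using (Fin; zero; suc; toℕ)
open import Data.Fin.Subset as Subset
  using (Subset; Nonempty; ⁅_⁆; ∁; ∣_∣; _∩_)
open import Data.Fin.Subset.Properties
  using (x∈⁅y⁆⇒x≡y; x∈p∩q⁻; x∈p⇒x∉∁p; ∪-identityˡ; ∪-identityʳ; ∣⁅x⁆∣≡1)
open import Data.Nat.Base using (ℕ; suc; _+_; _*_; _≤_)
open import Data.Nat.Divisibility
  using (_∣_; _∤_; divides-refl; ∣m∣n⇒∣m+n; ∣-refl; _∣0)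
open import Data.Nat.Properties using (n≤1+n)
open import Data.Product.Base using (_×_; _,_)
open import Data.Sum.Base using (_⊎_; inj₁; inj₂)
open import Data.Vec.Base using ([]; _∷_; here; there)
open import Level using (0ℓ)
open import Relation.Binary.PropositionalEquality using (_≡_; refl; cong)
open import Relation.Nullary using (¬_; contradiction)
open import Relation.Unary as U using (Pred; _∪_)

private
  variable
    n k : ℕ

data Literal (n : ℕ) : Set where
  pos neg : Fin n → Literal n

-- Disjunctions are taken up to commutativity, associativity and idempotence:
-- a clause is the set of its literals, split by sign.  It may be tautological.
record Clause (n : ℕ) : Set where
  constructor clause
  field
    positive negative : Subset n

open Clause public

□ : Clause n
□ = clause Subset.⊥ Subset.⊥

lit : Literal n → Clause n
lit (pos i) = clause ⁅ i ⁆ Subset.⊥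
lit (neg i) = clause Subset.⊥ ⁅ i ⁆

infixr 6 _∨_
_∨_ : Clause n → Clause n → Clause n
C ∨ D = clause (positive C Subset.∪ positive D) (negative C Subset.∪ negative D)

width : Clause n → ℕ
width C = ∣ positive C ∣ + ∣ negative C ∣

CNF : ℕ → Set₁
CNF n = Pred (Clause n) 0ℓ

-- An assignment is the set of variables it makes true, so that its weight
-- is ∣ α ∣.
Assignment : ℕ → Set
Assignment = Subset

infix 4 _⊨_
_⊨_ : Assignment n → Clause n → Set
α ⊨ C = Nonempty (positive C ∩ α) ⊎ Nonempty (negative C ∩ ∁ α)

record WeightedContradiction (n k : ℕ) : Set₁ where
  field
    formula       : CNF n
    three-CNF     : ∀ {C} → C U.∈ formula → width C ≤ 3
    unsatisfiable : ∀ (α : Assignment n) → ∣ α ∣ ≡ k →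
                    ¬ (∀ {C} → C U.∈ formula → α ⊨ C)

open WeightedContradiction public

data Resolvent {n} : (C D E : Clause n) → Set where
  resolvent : ∀ (P Q : Clause n) (x : Fin n) →
              Resolvent (P ∨ lit (pos x)) (Q ∨ lit (neg x)) (P ∨ Q)

data Weakening {n} : (C D : Clause n) → Set where
  weakening : ∀ (P : Clause n) (l : Literal n) → Weakening P (P ∨ lit l)

-- Nodes are numbered along a topological order, which makes the graph acyclic.
data Inference {n size} (F : CNF n) (label : Fin size → Clause n)
               (v : Fin size) : Set where
  initial : label v U.∈ F → Inference F label v
  resolve : ∀ u w → u Fin.< v → w Fin.< v →
            Resolvent (label u) (label w) (label v) → Inference F label v
  weaken  : ∀ u → u Fin.< v →
            Weakening (label u) (label v) → Inference F label v

data Premise {n size} {F : CNF n} {label : Fin size → Clause n} {v : Fin size} :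
             Fin size → Inference F label v → Set where
  left  : ∀ {u w u<v w<v r} → Premise u (resolve u w u<v w<v r)
  right : ∀ {u w u<v w<v r} → Premise w (resolve u w u<v w<v r)
  only  : ∀ {u u<v r}       → Premise u (weaken u u<v r)

record Refutation {n} (F : CNF n) : Set where
  field
    size      : ℕ
    label     : Fin size → Clause n
    inference : ∀ v → Inference F label v

  IsSink : Fin size → Set
  IsSink u = ∀ v → ¬ Premise u (inference v)

  field
    root        : Fin size
    root-empty  : label root ≡ □
    root-sink   : IsSink root
    unique-sink : ∀ u → IsSink u → u ≡ root

open Refutation public using (size)

-- ¬x_{i₁} ∨ … ∨ ¬x_{i_{k+1}}, where S = {i₁ < … < i_{k+1}}
data TooHeavy (n k : ℕ) : CNF n where
  too-heavy : ∀ (S : Subset n) → ∣ S ∣ ≡ suc k → TooHeavy n k (clause Subset.⊥ S)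

-- x_{i₁} ∨ … ∨ x_{i_{n-k+1}}; the equation says ∣ S ∣ = n - k + 1 without
-- truncated subtraction.
data TooLight (n k : ℕ) : CNF n where
  too-light : ∀ (S : Subset n) → ∣ S ∣ + k ≡ suc n → TooLight n k (clause S Subset.⊥)

W[1]-Refutation : WeightedContradiction n k → Set
W[1]-Refutation {n} {k} 𝓕 = Refutation (formula 𝓕 ∪ (TooHeavy n k ∪ TooLight n k))

-- The variables are indexed from 0, so v₁, v₃, …, v_{n-1} are the
-- variables of even index.
data Pairing (n : ℕ) : CNF n where
  forward  : ∀ (i j : Fin n) → 2 ∣ toℕ i → toℕ j ≡ suc (toℕ i) →
             Pairing n (lit (pos i) ∨ lit (neg j))
  backward : ∀ (i j : Fin n) → 2 ∣ toℕ i → toℕ j ≡ suc (toℕ i) →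
             Pairing n (lit (pos j) ∨ lit (neg i))

width-binary : ∀ (i j : Fin n) → width (lit (pos i) ∨ lit (neg j)) ≤ 3
width-binary i j
  rewrite ∪-identityʳ ⁅ i ⁆ | ∪-identityˡ ⁅ j ⁆ | ∣⁅x⁆∣≡1 i | ∣⁅x⁆∣≡1 j = n≤1+n 2

pairing-width : ∀ {C : Clause n} → Pairing n C → width C ≤ 3
pairing-width (forward i j _ _)  = width-binary i j
pairing-width (backward i j _ _) = width-binary j i

implication : ∀ (α : Assignment n) (i j : Fin n) →
              α ⊨ lit (pos i) ∨ lit (neg j) → j Subset.∈ α → i Subset.∈ α
implication α i j (inj₁ (x , x∈)) _
  with x∈P , x∈α ← x∈p∩q⁻ _ α x∈
  rewrite ∪-identityʳ ⁅ i ⁆ | x∈⁅y⁆⇒x≡y i x∈P = x∈α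
implication α i j (inj₂ (x , x∈)) j∈α
  with x∈N , x∈∁α ← x∈p∩q⁻ _ (∁ α) x∈
  rewrite ∪-identityˡ ⁅ j ⁆ | x∈⁅y⁆⇒x≡y j x∈N = contradiction x∈∁α (x∈p⇒x∉∁p j∈α)

Paired : Assignment n → Set
Paired α = ∀ i j → 2 ∣ toℕ i → toℕ j ≡ suc (toℕ i) →
           (j Subset.∈ α → i Subset.∈ α) × (i Subset.∈ α → j Subset.∈ α)

paired-tail : ∀ {a b} {α : Assignment n} → Paired (a ∷ b ∷ α) → Paired α
paired-tail p i j 2∣i j≡1+i
  with f , g ← p (suc (suc i)) (suc (suc j)) (∣m∣n⇒∣m+n ∣-refl 2∣i) (cong (2 +_) j≡1+i)
  = (λ j∈ → drop² (f (there (there j∈)))) , (λ i∈ → drop² (g (there (there i∈))))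
  where
  drop² : ∀ {m a b} {α : Assignment m} {i} →
          suc (suc i) Subset.∈ (a ∷ b ∷ α) → i Subset.∈ α
  drop² (there (there i∈)) = i∈

paired⇒even : ∀ m (α : Assignment (m * 2)) → Paired α → 2 ∣ ∣ α ∣
paired⇒even 0       []                _ = 2 ∣0
paired⇒even (suc m) (false ∷ false ∷ α) p = paired⇒even m α (paired-tail p)
paired⇒even (suc m) (true  ∷ true  ∷ α) p =
  ∣m∣n⇒∣m+n ∣-refl (paired⇒even m α (paired-tail p))
paired⇒even (suc m) (false ∷ true  ∷ α) p
  with f , _ ← p zero (suc zero) (2 ∣0) refl with () ← f (there here)
paired⇒even (suc m) (true  ∷ false ∷ α) p
  with _ , g ← p zero (suc zero) (2 ∣0) refl with there () ← g here

pairing-unsatisfiable : 2 ∣ n → 2 ∤ k → (α : Assignment n) → ∣ α ∣ ≡ k →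
                        ¬ (∀ {C} → Pairing n C → α ⊨ C)
pairing-unsatisfiable (divides-refl m) 2∤k α refl sat =
  2∤k (paired⇒even m α λ i j 2∣i j≡1+i →
    implication α i j (sat (forward i j 2∣i j≡1+i)) ,
    implication α j i (sat (backward i j 2∣i j≡1+i)))

Ψ : ∀ n k → 2 ∣ n → 2 ∤ k → WeightedContradiction n k
Ψ n k 2∣n 2∤k = record
  { formula       = Pairing n
  ; three-CNF     = pairing-width
  ; unsatisfiable = pairing-unsatisfiable 2∣n 2∤k
  }

-- A paired assignment of weight k + 1 satisfies every initial clause except the
-- too-heavy clause on exactly its own variables.  Following falsified premises
-- down from the root, a refutation therefore contains that clause, so its size
-- is at least the number of paired assignments of weight k + 1.  With s = (k + 1)/2,
-- these include those choosing one pair from each of s disjoint blocks of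
-- q = ⌊(n/2)/s⌋ pairs, so the size is at least q ^ s.  Its square is q · q ^ k,
-- and the surplus factor q outgrows the constant (n/2q) ^ k ≤ (k + 1) ^ k.
module Submission where

open import Defs
open import Data.Bool.Base using (true; false)
open import Data.Fin.Base as Fin using (Fin; zero; suc; combine; quotient; remainder)
open import Data.Fin.Induction using (<-wellFounded)
open import Data.Fin.Properties using (combine-remQuot; injective⇒≤)
open import Data.Fin.Subset as Subset
  using (Subset; Nonempty; ⁅_⁆; ∁; ∣_∣; _∩_; _∈_; _⊆_)
open import Data.Fin.Subset.Properties
  using (x∈⁅x⁆; x∈⁅y⁆⇒x≡y; x∈p∩q⁺; x∈p∩q⁻; x∈p∪q⁺; x∈p∪q⁻; x∉p⇒x∈∁p; x∈∁p⇒x∉p;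
         x∉∁p⇒x∈p; p⊆q⇒∣p∣≤∣q∣; p⊂q⇒∣p∣<∣q∣; ∣⁅x⁆∣≡1; ∣⊥∣≡0; ∣∁p∣≡n∸∣p∣; ∣p∣≤n;
         ⊆-antisym; nonempty?; _∈?_; ∉⊥)
open import Data.Nat.Base using (ℕ; zero; suc; _+_; _*_; _∸_; _≤_; _^_; _/_; _%_; >-nonZero)
open import Data.Nat.Divisibility
  using (_∣_; _∤_; divides-refl; _∣0; ∣m+n∣m⇒∣n; ∣m∣n⇒∣m+n; ∣-refl; >⇒∤)
open import Data.Nat.DivMod using (m≡m%n+[m/n]*n; m%n≤n; m*n/n≡m; /-monoˡ-≤)
open import Data.Nat.Properties
open import Data.Product.Base using (∃-syntax; _×_; _,_; proj₁; proj₂)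
open import Data.Sum.Base as Sum using (_⊎_; inj₁; inj₂; [_,_]′)
open import Data.Vec.Base using ([]; _∷_; _++_; here; there)
open import Data.Vec.Properties using (++-injective; ++-injectiveʳ; ∷-injective)
open import Function.Base using (_∘_)
open import Function.Definitions using (Injective)
open import Induction.WellFounded using (Acc; acc)
open import Relation.Binary.PropositionalEquality
  using (_≡_; refl; sym; trans; cong; cong₂; subst; module ≡-Reasoning)
open import Relation.Nullary using (¬_; Dec; yes; no; contradiction)
open import Relation.Nullary.Decidable using (_⊎-dec_; decidable-stable)
import Relation.Unary as U

private
  variable
    n k m : ℕ
    α : Assignment n
    C D E : Clause n

-- Truth of clauses under an assignment.

∪∩-nonempty⁻ : ∀ (p q r : Subset n) → Nonempty ((p Subset.∪ q) ∩ r) →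
               Nonempty (p ∩ r) ⊎ Nonempty (q ∩ r)
∪∩-nonempty⁻ p q r (x , x∈) with x∈p∩q⁻ (p Subset.∪ q) r x∈
... | x∈p∪q , x∈r =
  Sum.map (λ x∈p → x , x∈p∩q⁺ (x∈p , x∈r)) (λ x∈q → x , x∈p∩q⁺ (x∈q , x∈r))
          (x∈p∪q⁻ p q x∈p∪q)

∪∩-nonempty⁺ : ∀ (p q r : Subset n) → Nonempty (p ∩ r) ⊎ Nonempty (q ∩ r) →
               Nonempty ((p Subset.∪ q) ∩ r)
∪∩-nonempty⁺ p q r (inj₁ (x , x∈)) with x∈p∩q⁻ p r x∈
... | x∈p , x∈r = x , x∈p∩q⁺ (x∈p∪q⁺ (inj₁ x∈p) , x∈r)
∪∩-nonempty⁺ p q r (inj₂ (x , x∈)) with x∈p∩q⁻ q r x∈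
... | x∈q , x∈r = x , x∈p∩q⁺ (x∈p∪q⁺ (inj₂ x∈q) , x∈r)

⊨-∨⁻ : ∀ (C D : Clause n) → α ⊨ C ∨ D → α ⊨ C ⊎ α ⊨ D
⊨-∨⁻ C D (inj₁ t) = Sum.map inj₁ inj₁ (∪∩-nonempty⁻ (positive C) (positive D) _ t)
⊨-∨⁻ C D (inj₂ t) = Sum.map inj₂ inj₂ (∪∩-nonempty⁻ (negative C) (negative D) _ t)

⊨-∨⁺ˡ : ∀ (C D : Clause n) → α ⊨ C → α ⊨ C ∨ D
⊨-∨⁺ˡ C D = Sum.map (∪∩-nonempty⁺ (positive C) (positive D) _ ∘ inj₁)
                    (∪∩-nonempty⁺ (negative C) (negative D) _ ∘ inj₁)

⊨-∨⁺ʳ : ∀ (C D : Clause n) → α ⊨ D → α ⊨ C ∨ D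
⊨-∨⁺ʳ C D = Sum.map (∪∩-nonempty⁺ (positive C) (positive D) _ ∘ inj₂)
                    (∪∩-nonempty⁺ (negative C) (negative D) _ ∘ inj₂)

⊨-pos⁺ : ∀ {i} → i ∈ α → α ⊨ lit (pos i)
⊨-pos⁺ {i = i} i∈α = inj₁ (i , x∈p∩q⁺ (x∈⁅x⁆ i , i∈α))

⊨-neg⁺ : ∀ {i} → ¬ i ∈ α → α ⊨ lit (neg i)
⊨-neg⁺ {i = i} i∉α = inj₂ (i , x∈p∩q⁺ (x∈⁅x⁆ i , x∉p⇒x∈∁p i∉α))

⊨-pos⁻ : ∀ {i} → α ⊨ lit (pos i) → i ∈ α
⊨-pos⁻ {i = i} (inj₁ (x , x∈)) with x∈p∩q⁻ ⁅ i ⁆ _ x∈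
... | x∈⁅i⁆ , x∈α = subst (_∈ _) (x∈⁅y⁆⇒x≡y i x∈⁅i⁆) x∈α
⊨-pos⁻ (inj₂ (x , x∈)) = contradiction (proj₁ (x∈p∩q⁻ Subset.⊥ _ x∈)) ∉⊥

⊨-neg⁻ : ∀ {i} → α ⊨ lit (neg i) → ¬ i ∈ α
⊨-neg⁻ (inj₁ (x , x∈)) = contradiction (proj₁ (x∈p∩q⁻ Subset.⊥ _ x∈)) ∉⊥
⊨-neg⁻ {i = i} (inj₂ (x , x∈)) i∈α with x∈p∩q⁻ ⁅ i ⁆ _ x∈
... | x∈⁅i⁆ , x∈∁α = x∈∁p⇒x∉p x∈∁α (subst (_∈ _) (sym (x∈⁅y⁆⇒x≡y i x∈⁅i⁆)) i∈α)

⊭□ : ¬ α ⊨ □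
⊭□ = [ absurd , absurd ]′
  where
  absurd : ∀ {r : Subset n} → ¬ Nonempty (Subset.⊥ ∩ r)
  absurd (x , x∈) = ∉⊥ (proj₁ (x∈p∩q⁻ Subset.⊥ _ x∈))

_⊨?_ : ∀ (α : Assignment n) C → Dec (α ⊨ C)
α ⊨? C = nonempty? (positive C ∩ α) ⊎-dec nonempty? (negative C ∩ ∁ α)

-- Soundness of the rules and descent to a falsified initial clause.

resolvent-sound : Resolvent C D E → α ⊨ C → α ⊨ D → α ⊨ E
resolvent-sound (resolvent P Q x) αC αD with ⊨-∨⁻ P _ αC | ⊨-∨⁻ Q _ αD
... | inj₁ αP | _       = ⊨-∨⁺ˡ P Q αP
... | inj₂ _  | inj₁ αQ = ⊨-∨⁺ʳ P Q αQ
... | inj₂ αx | inj₂ αx̄ = contradiction (⊨-pos⁻ αx) (⊨-neg⁻ αx̄)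

weakening-sound : Weakening C D → α ⊨ C → α ⊨ D
weakening-sound (weakening P l) = ⊨-∨⁺ˡ P (lit l)

module _ {F : CNF n} (π : Refutation F) (α : Assignment n) where
  open Refutation π hiding (size)

  -- Every assignment falsifies the empty clause at the root. By soundness, a falsified conclusion
  -- has a falsified premise; if the left one is true, it is the right one. Premises have smaller
  -- indices, so the descent ends, and only at an initial clause.
  falsified-initial : ∃[ v ] label v U.∈ F × ¬ α ⊨ label v
  falsified-initial = descend root (<-wellFounded root) λ t → ⊭□ (subst (α ⊨_) root-empty t)
    where
    descend : ∀ v → Acc Fin._<_ v → ¬ α ⊨ label v → ∃[ u ] label u U.∈ F × ¬ α ⊨ label u
    descend v (acc rs) ⊭v with inference v
    ... | initial v∈F         = v , v∈F , ⊭v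
    ... | weaken u u<v r      = descend u (rs u<v) (⊭v ∘ weakening-sound r)
    ... | resolve u w u<v w<v r with α ⊨? label u
    ...   | no  ⊭u = descend u (rs u<v) ⊭u
    ...   | yes ⊨u = descend w (rs w<v) (⊭v ∘ resolvent-sound r ⊨u)

-- Initial clauses under paired assignments of weight k + 1.

paired⇒⊨ : Paired α → Pairing n C → α ⊨ C
paired⇒⊨ {α = α} p (forward i j 2∣i j≡1+i) with j ∈? α
... | yes j∈α = ⊨-∨⁺ˡ (lit (pos i)) (lit (neg j)) (⊨-pos⁺ (proj₁ (p i j 2∣i j≡1+i) j∈α))
... | no  j∉α = ⊨-∨⁺ʳ (lit (pos i)) (lit (neg j)) (⊨-neg⁺ j∉α)
paired⇒⊨ {α = α} p (backward i j 2∣i j≡1+i) with i ∈? α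
... | yes i∈α = ⊨-∨⁺ˡ (lit (pos j)) (lit (neg i)) (⊨-pos⁺ (proj₂ (p i j 2∣i j≡1+i) i∈α))
... | no  i∉α = ⊨-∨⁺ʳ (lit (pos j)) (lit (neg i)) (⊨-neg⁺ i∉α)

⊆∧∣∣≡⇒≡ : ∀ {p q : Subset n} → p ⊆ q → ∣ p ∣ ≡ ∣ q ∣ → p ≡ q
⊆∧∣∣≡⇒≡ {p = p} {q} p⊆q eq = ⊆-antisym p⊆q λ {x} x∈q →
  decidable-stable (x ∈? p) λ x∉p →
    <⇒≢ (p⊂q⇒∣p∣<∣q∣ (p⊆q , x , x∈q , x∉p)) eq

-- If `S` missed `α`, it would lie in the complement of `α`, giving `∣ S ∣ + ∣ α ∣ ≤ n`; but this
-- sum is n + 2.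
too-light-sound : ∣ α ∣ ≡ suc k → TooLight n k C → α ⊨ C
too-light-sound {n = n} {α = α} {k = k} ∣α∣≡1+k (too-light S ∣S∣+k≡1+n)
  with nonempty? (S ∩ α)
... | yes t = inj₁ t
... | no ¬t = contradiction (begin
  suc n + 1       ≡⟨ cong (_+ 1) ∣S∣+k≡1+n ⟨
  ∣ S ∣ + k + 1   ≡⟨ +-assoc ∣ S ∣ k 1 ⟩
  ∣ S ∣ + (k + 1) ≡⟨ cong (∣ S ∣ +_) (trans (+-comm k 1) (sym ∣α∣≡1+k)) ⟩
  ∣ S ∣ + ∣ α ∣   ≤⟨ +-monoˡ-≤ ∣ α ∣ (p⊆q⇒∣p∣≤∣q∣ S⊆∁α) ⟩
  ∣ ∁ α ∣ + ∣ α ∣ ≡⟨ cong (_+ ∣ α ∣) (∣∁p∣≡n∸∣p∣ α) ⟩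
  n ∸ ∣ α ∣ + ∣ α ∣ ≡⟨ m∸n+n≡m (∣p∣≤n α) ⟩
  n               ∎) (<⇒≱ (m≤m+n (suc n) 1))
  where
  open ≤-Reasoning
  S⊆∁α : S ⊆ ∁ α
  S⊆∁α {x} x∈S = x∉p⇒x∈∁p λ x∈α → ¬t (x , x∈p∩q⁺ (x∈S , x∈α))

-- Falsifying the clause on `S` means `S ⊆ α`, and both sets have k + 1 elements, so they coincide.
too-heavy-falsified : ∣ α ∣ ≡ suc k → TooHeavy n k C → ¬ α ⊨ C → C ≡ clause Subset.⊥ α
too-heavy-falsified ∣α∣≡1+k (too-heavy S ∣S∣≡1+k) ⊭C = cong (clause Subset.⊥)
  (⊆∧∣∣≡⇒≡ (λ {x} x∈S → x∉∁p⇒x∈p λ x∈∁α → ⊭C (inj₂ (x , x∈p∩q⁺ (x∈S , x∈∁α))))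
           (trans ∣S∣≡1+k (sym ∣α∣≡1+k)))

too-heavy-clause-occurs :
  (π : Refutation (Pairing n U.∪ (TooHeavy n k U.∪ TooLight n k))) →
  Paired α → ∣ α ∣ ≡ suc k → ∃[ v ] Refutation.label π v ≡ clause Subset.⊥ α
too-heavy-clause-occurs {α = α} π p ∣α∣≡1+k with falsified-initial π α
... | v , inj₁ v∈Ψ , ⊭v        = contradiction (paired⇒⊨ p v∈Ψ) ⊭v
... | v , inj₂ (inj₁ v∈H) , ⊭v = v , too-heavy-falsified ∣α∣≡1+k v∈H ⊭v
... | v , inj₂ (inj₂ v∈L) , ⊭v = contradiction (too-light-sound ∣α∣≡1+k v∈L) ⊭v

-- From sets of pairs to distinct nodes.

double : Subset m → Subset (m * 2)
double []      = []
double (b ∷ p) = b ∷ b ∷ double p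

double-injective : Injective _≡_ _≡_ (double {m})
double-injective {x = []}    {[]}    _  = refl
double-injective {x = a ∷ p} {b ∷ q} eq with ∷-injective eq
... | a≡b , eq′ = cong₂ _∷_ a≡b (double-injective (proj₂ (∷-injective eq′)))

∣double∣ : ∀ (p : Subset m) → ∣ double p ∣ ≡ ∣ p ∣ * 2
∣double∣ []          = refl
∣double∣ (true  ∷ p) = cong (2 +_) (∣double∣ p)
∣double∣ (false ∷ p) = ∣double∣ p

paired-double : ∀ (p : Subset m) → Paired (double p)
paired-double (b ∷ p) zero (suc zero) _ _ = (λ { (there here) → here }) , λ { here → there here }
paired-double (b ∷ p) (suc zero) j 2∣1 _ = contradiction 2∣1 (>⇒∤ ≤-refl)
paired-double (b ∷ p) (suc (suc i)) (suc (suc j)) 2∣2+i eq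
  with f , g ← paired-double p i j (∣m+n∣m⇒∣n 2∣2+i ∣-refl) (suc-injective (suc-injective eq))
  = (λ { (there (there j∈)) → there (there (f j∈)) })
  , (λ { (there (there i∈)) → there (there (g i∈)) })

-- Each index is sent to a node carrying the too-heavy clause of its doubled set. The negative
-- literals of that label give back the set, so distinct indices get distinct nodes.
size-bound : ∀ {N} (e : Fin N → Subset m) → Injective _≡_ _≡_ e →
             (∀ x → ∣ e x ∣ * 2 ≡ suc k) →
             (π : Refutation (Pairing (m * 2) U.∪ (TooHeavy (m * 2) k U.∪ TooLight (m * 2) k))) →
             N ≤ size π
size-bound e e-injective weight π = injective⇒≤ {f = proj₁ ∘ node} λ {x} {y} eq →
  e-injective (double-injective (cong negative
    (trans (sym (proj₂ (node x)))
           (trans (cong (Refutation.label π) eq) (proj₂ (node y))))))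
  where
  node : ∀ x → ∃[ v ] Refutation.label π v ≡ clause Subset.⊥ (double (e x))
  node x = too-heavy-clause-occurs π (paired-double (e x)) (trans (∣double∣ (e x)) (weight x))

-- Transversals of blocks of pairs.

∣++∣ : ∀ (p : Subset m) (r : Subset n) → ∣ p ++ r ∣ ≡ ∣ p ∣ + ∣ r ∣
∣++∣ []          r = refl
∣++∣ (true  ∷ p) r = cong suc (∣++∣ p r)
∣++∣ (false ∷ p) r = ∣++∣ p r

-- The index is read as `s` digits in base `q`, leading digit first; each digit picks one element of
-- its own block of size `q`.
transversal : ∀ {q} s → Fin (q ^ s) → Subset (s * q)
transversal zero            _ = []
transversal {q = q} (suc s) x =
  ⁅ quotient {q} (q ^ s) x ⁆ ++ transversal s (remainder {q} (q ^ s) x)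

∣transversal∣ : ∀ {q} s (x : Fin (q ^ s)) → ∣ transversal s x ∣ ≡ s
∣transversal∣         zero    _ = refl
∣transversal∣ {q = q} (suc s) x = trans (∣++∣ ⁅ quotient {q} (q ^ s) x ⁆ _)
  (cong₂ _+_ (∣⁅x⁆∣≡1 (quotient {q} (q ^ s) x)) (∣transversal∣ s (remainder {q} (q ^ s) x)))

⁅⁆-injective : Injective _≡_ _≡_ (⁅_⁆ {n})
⁅⁆-injective {x = x} {y} eq = x∈⁅y⁆⇒x≡y y (subst (x ∈_) eq (x∈⁅x⁆ x))

-- The singleton on the first block determines the leading digit and the other blocks determine the
-- remaining ones; `combine` rebuilds the index from both.
transversal-injective : ∀ {q} s → Injective _≡_ _≡_ (transversal {q} s)
transversal-injective zero {zero} {zero} _ = refl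
transversal-injective {q} (suc s) {x} {y} eq
  with ++-injective ⁅ quotient {q} (q ^ s) x ⁆ ⁅ quotient {q} (q ^ s) y ⁆ eq
... | eq₁ , eq₂ = begin
  x ≡⟨ combine-remQuot {q} (q ^ s) x ⟨
  combine (quotient {q} (q ^ s) x) (remainder {q} (q ^ s) x)
    ≡⟨ cong₂ combine (⁅⁆-injective eq₁) (transversal-injective s eq₂) ⟩
  combine (quotient {q} (q ^ s) y) (remainder {q} (q ^ s) y)
    ≡⟨ combine-remQuot {q} (q ^ s) y ⟩
  y ∎
  where open ≡-Reasoning

-- The `t` pairs left over after cutting off `s` blocks of size `q` are all set to false.
transversal-bound : ∀ {q} s t → m ≡ t + s * q → s * 2 ≡ suc k →
  (π : Refutation (Pairing (m * 2) U.∪ (TooHeavy (m * 2) k U.∪ TooLight (m * 2) k))) →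
  q ^ s ≤ size π
transversal-bound s t refl s*2≡1+k = size-bound (λ x → Subset.⊥ {t} ++ transversal s x)
  (λ eq → transversal-injective s (++-injectiveʳ (Subset.⊥ {t}) Subset.⊥ eq))
  (λ x → trans (cong (_* 2) (trans (∣++∣ (Subset.⊥ {t}) (transversal s x))
                                   (cong₂ _+_ (∣⊥∣≡0 t) (∣transversal∣ s x))))
               s*2≡1+k)

-- Arithmetic of the bound.

odd⇒suc-even : 2 ∤ k → ∃[ r ] suc r * 2 ≡ suc k
odd⇒suc-even {zero}        odd = contradiction (2 ∣0) odd
odd⇒suc-even {suc zero}    odd = 0 , refl
odd⇒suc-even {suc (suc k)} odd with odd⇒suc-even {k} (odd ∘ ∣m∣n⇒∣m+n ∣-refl)
... | r , eq = suc r , cong (2 +_) eq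

^-distribʳ-* : ∀ a b k → (a * b) ^ k ≡ a ^ k * b ^ k
^-distribʳ-* a b zero    = refl
^-distribʳ-* a b (suc k) = trans (cong (a * b *_) (^-distribʳ-* a b k)) ([m*n]*[o*p]≡[m*o]*[n*p] a b (a ^ k) (b ^ k))

lemma3 : ∀ (k : ℕ) (k-odd : 2 ∤ k) →
    ∃[ N ] (∀ (n : ℕ) (n-even : 2 ∣ n) → N ≤ n →
    ∀ (π : W[1]-Refutation (Ψ n k n-even k-odd)) →
    (n / 2) ^ k ≤ size π ^ 2)
lemma3 k k-odd with odd⇒suc-even k-odd
-- The threshold is chosen to make `q` at least (k + 1)^k: with n = 2m and k + 1 = 2s it says that
-- (k + 1)^k * s ≤ m.
... | r , s*2≡1+k = suc k ^ suc k , bound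
  where
  open ≤-Reasoning
  -- The successor form makes `s` visibly nonzero, so that division by `s` is defined.
  s = suc r

  bound : ∀ n (n-even : 2 ∣ n) → suc k ^ suc k ≤ n →
          (π : W[1]-Refutation (Ψ n k n-even k-odd)) → (n / 2) ^ k ≤ size π ^ 2
  bound n (divides-refl m) N≤n π = begin
    (m * 2 / 2) ^ k   ≡⟨ cong (_^ k) (m*n/n≡m m 2) ⟩
    m ^ k             ≤⟨ ^-monoˡ-≤ k m≤[1+k]q ⟩
    (suc k * q) ^ k   ≡⟨ ^-distribʳ-* (suc k) q k ⟩
    -- The exponent k + 1 exceeds k by one, and that extra factor `q` absorbs the constant lost by
    -- rounding and by cutting into blocks.
    suc k ^ k * q ^ k ≤⟨ *-monoˡ-≤ (q ^ k) [1+k]^k≤q ⟩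
    q ^ suc k         ≡⟨ cong (q ^_) s*2≡1+k ⟨
    q ^ (s * 2)       ≡⟨ ^-*-assoc q s 2 ⟨
    (q ^ s) ^ 2       ≤⟨ ^-monoˡ-≤ 2 (transversal-bound s (m % s) m≡ s*2≡1+k π) ⟩
    size π ^ 2        ∎
    where
    q = m / s

    m≡ : m ≡ m % s + s * q
    m≡ = trans (m≡m%n+[m/n]*n m s) (cong (m % s +_) (*-comm q s))

    [1+k]^k≤q : suc k ^ k ≤ q
    [1+k]^k≤q = begin
      suc k ^ k         ≡⟨ m*n/n≡m (suc k ^ k) s ⟨
      suc k ^ k * s / s ≤⟨ /-monoˡ-≤ s (*-cancelʳ-≤ (suc k ^ k * s) m 2 (begin
        suc k ^ k * s * 2   ≡⟨ *-assoc (suc k ^ k) s 2 ⟩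
        suc k ^ k * (s * 2) ≡⟨ cong (suc k ^ k *_) s*2≡1+k ⟩
        suc k ^ k * suc k   ≡⟨ *-comm (suc k ^ k) (suc k) ⟩
        suc k ^ suc k       ≤⟨ N≤n ⟩
        m * 2               ∎)) ⟩
      q                 ∎

    m≤[1+k]q : m ≤ suc k * q
    m≤[1+k]q = begin
      m             ≡⟨ m≡ ⟩
      m % s + s * q ≤⟨ +-monoˡ-≤ (s * q) (m%n≤n m s) ⟩
      -- The remainder, bounded by `s`, fits into one more copy of `s * q` because `q` is positive,
      -- being at least (k + 1)^k.
      s + s * q     ≤⟨ +-monoˡ-≤ (s * q) (m≤m*n s q {{>-nonZero (≤-trans (m^n>0 (suc k) k) [1+k]^k≤q)}}) ⟩
      s * q + s * q ≡⟨ *-distribʳ-+ q s s ⟨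
      (s + s) * q   ≡⟨ cong (_* q) (trans (cong (s +_) (sym (+-identityʳ s))) (trans (*-comm 2 s) s*2≡1+k)) ⟩
      suc k * q     ∎
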